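{- Let $\mathfrak{F}_1,\mathfrak{F}_1',\mathfrak{F}_2,\mathfrak{F}_2'$ be the classes of $\hat N$-frames, $\hat N'$-frames, sub-normal frames and sub-normal identity frames respectively. Let $\Phi:\mathfrak{F}_2\to\mathfrak{F}_1$ send $(W,\leq,Y_0)$ to $(W,\leq,R_{N_1},R_{N_2})$, where $xR_{N_1}y$ iff $\exists z(x\leq z\ \&\ y\leq z)$ and $xR_{N_2}y$ iff $\exists z(x\leq z\ \&\ y\leq z\ \&\ z\notin Y_0)$; and let $\Psi:\mathfrak{F}_1\to\mathfrak{F}_2$ send $(W,\leq,R_{N_1},R_{N_2})$ to $(W,\leq,Y_0)$, where $Y_0=\{z\in W:\text{there is no }x\in W\text{ with }zR_{N_2}x\}$. Then: 1. (a) $\Phi\Psi$ and $\Psi\Phi$ are the identity maps on $\mathfrak{F}_1$ and $\mathfrak{F}_2$ respectively. (b) $\Phi|_{\mathfrak{F}_2'}\Psi|_{\mathfrak{F}_1'}$ and $\Psi|_{\mathfrak{F}_1'}\Phi|_{\mathfrak{F}_2'}$ are the identity maps on $\mathfrak{F}_1'$ and $\mathfrak{F}_2'$ respectively. 2. For every formula $\alpha\in F$: (a) $\mathfrak{F}_1\vDash\alpha\Leftrightarrow\mathfrak{F}_2\vDash\alpha$, and (b) $\mathfrak{F}_1'\vDash\alpha\Leftrightarrow\mathfrak{F}_2'\vDash\alpha$.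
   Context: $F$ is the set of formulas built from propositional variables and constants $\top,\bot$ with $\wedge,\vee,\rightarrow,\neg,\sim$. A sub-normal frame is $(W,\leq,Y_0)$ with $(W,\leq)$ a nonempty poset and $Y_0\subseteq W$ an upset such that for all $x\in W$: if for every $y\geq x$ there is $z\geq y$ with $z\in Y_0$, then $x\in Y_0$. It is a sub-normal identity frame if moreover for all $x,y\in W\setminus Y_0$, $x\leq y$ implies $y\leq x$. A strictly condensed $J$-frame is a triple $(X,\leq,R_N)$ with $(X,\leq)$ a nonempty poset and $R_N$ a binary relation on $X$ such that: (i) $x\leq x'$, $x'R_Ny'$, $y\leq y'$ imply $xR_Ny$; (ii) $R_N$ is symmetric; (iii) $\forall x,y\,(xR_Ny\Rightarrow\exists z(x\leq z\ \&\ y\leq z\ \&\ xR_Nz))$. It is a strictly condensed $H$-frame if moreover $R_N$ is reflexive. An $\hat N$-frame is $(X,\leq,R_{N_1},R_{N_2})$ such that (1) $(X,\leq,R_{N_1})$ is a strictly condensed $H$-frame; (2) $(X,\leq,R_{N_2})$ is a strictly condensed $J$-frame; (3) for all $x\in X$: if for every $y$ with $xR_{N_1}y$ there is $z$ with $yR_{N_1}z$ and no $z'$ with $zR_{N_2}z'$, then there is no $z''$ with $xR_{N_2}z''$. An $\hat N'$-frame is an $\hat N$-frame such that $xR_{N_2}y$ implies $y\leq x$. ($\Phi$ and $\Psi$ are well defined between the indicated classes, and restrict to maps between $\mathfrak{F}_2'$ and $\mathfrak{F}_1'$.) On either kind of frame, a valuation assigns an upset to each propositional variable. Truth: variables via $v$;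 $\top$ everywhere, $\bot$ nowhere; $\wedge,\vee$ pointwise; $x\vDash\alpha\rightarrow\beta$ iff for all $y\geq x$, $y\vDash\alpha$ implies $y\vDash\beta$. On sub-normal frames: $x\vDash\neg\alpha$ iff for all $y\geq x$, $y\nvDash\alpha$; $x\vDash\sim\alpha$ iff for all $y\geq x$, $y\vDash\alpha$ implies $y\in Y_0$. On $\hat N$-frames: $x\vDash\neg\alpha$ iff for all $y$, $xR_{N_1}y$ implies $y\nvDash\alpha$; $x\vDash\sim\alpha$ iff for all $y$, $xR_{N_2}y$ implies $y\nvDash\alpha$. For a class $\mathfrak{F}$ of frames, $\mathfrak{F}\vDash\alpha$ means $\alpha$ is true at every point under every valuation on every frame in $\mathfrak{F}$. -}

module Defs where

open import Level using (Level; suc)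
open import Axiom.ExcludedMiddle using (ExcludedMiddle)
open import Axiom.DoubleNegationElimination using (em⇒dne)
open import Data.Empty.Polymorphic using (⊥)
open import Data.Product using (∃; ∃-syntax; _×_; _,_)
open import Data.Sum using (_⊎_)
open import Data.Unit.Polymorphic using (⊤)
open import Function.Base using (id; _∘_)
open import Function.Bundles using (_⇔_)
open import Relation.Binary.Core using (Rel)
open import Relation.Binary.Definitions using (Reflexive; Symmetric; _Respects_)
open import Relation.Binary.PropositionalEquality using (_≡_; subst)
open import Relation.Binary.Structures using (IsPartialOrder)
open import Relation.Nullary using (¬_)
open import Relation.Unary using (Pred; _∈_; _∉_)

infixr 6 _∧ᶠ_
infixr 5 _∨ᶠ_
infixr 4 _→ᶠ_

data Formula (Var : Set) : Set where
  var            : Var → Formula Var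
  ⊤ᶠ ⊥ᶠ          : Formula Var
  _∧ᶠ_ _∨ᶠ_ _→ᶠ_ : (α β : Formula Var) → Formula Var
  ¬ᶠ_ ∼ᶠ_        : (α : Formula Var) → Formula Var

record IsNonemptyPoset {ℓ} {X : Set ℓ} (_≤_ : Rel X ℓ) : Set ℓ where
  field
    point          : X
    isPartialOrder : IsPartialOrder _≡_ _≤_

  open IsPartialOrder isPartialOrder public using (refl; trans; antisym)

-- P Respects _≤_ unfolds to: x ≤ y and P x imply P y.
IsUpset : ∀ {ℓ} {X : Set ℓ} → Rel X ℓ → Pred X ℓ → Set ℓ
IsUpset _≤_ P = P Respects _≤_

record SubNormalFrame (ℓ : Level) : Set (suc ℓ) where
  infix 4 _≤_
  field
    W               : Set ℓ
    _≤_             : Rel W ℓ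
    Y₀              : Pred W ℓ
    isNonemptyPoset : IsNonemptyPoset _≤_
    Y₀-upset        : IsUpset _≤_ Y₀
    Y₀-cofinal      : ∀ x → (∀ y → x ≤ y → ∃[ z ] (y ≤ z × z ∈ Y₀)) → x ∈ Y₀

  open IsNonemptyPoset isNonemptyPoset public

IsIdentity : ∀ {ℓ} → Pred (SubNormalFrame ℓ) ℓ
IsIdentity F = ∀ x y → x ∉ Y₀ → y ∉ Y₀ → x ≤ y → y ≤ x
  where open SubNormalFrame F

record IsStrictlyCondensedJFrame {ℓ} {X : Set ℓ} (_≤_ R : Rel X ℓ) : Set ℓ where
  field
    isNonemptyPoset : IsNonemptyPoset _≤_
    down            : ∀ {x x′ y y′} → x ≤ x′ → R x′ y′ → y ≤ y′ → R x y
    symmetric       : Symmetric R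
    condensed       : ∀ {x y} → R x y → ∃[ z ] (x ≤ z × y ≤ z × R x z)

  open IsNonemptyPoset isNonemptyPoset public

record IsStrictlyCondensedHFrame {ℓ} {X : Set ℓ} (_≤_ R : Rel X ℓ) : Set ℓ where
  field
    isJFrame  : IsStrictlyCondensedJFrame _≤_ R
    reflexive : Reflexive R

  open IsStrictlyCondensedJFrame isJFrame public

record NHatFrame (ℓ : Level) : Set (suc ℓ) where
  infix 4 _≤_
  field
    X        : Set ℓ
    _≤_      : Rel X ℓ
    RN₁ RN₂  : Rel X ℓ
    isHFrame : IsStrictlyCondensedHFrame _≤_ RN₁
    isJFrame : IsStrictlyCondensedJFrame _≤_ RN₂
    link     : ∀ x →
               (∀ y → RN₁ x y → ∃[ z ] (RN₁ y z × ¬ (∃[ z′ ] RN₂ z z′))) →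
               ¬ (∃[ z″ ] RN₂ x z″)

IsNHat′ : ∀ {ℓ} → Pred (NHatFrame ℓ) ℓ
IsNHat′ F = ∀ x y → RN₂ x y → y ≤ x
  where open NHatFrame F

𝔉₁ 𝔉₁′ : ∀ {ℓ} → Pred (NHatFrame ℓ) ℓ
𝔉₁ _ = ⊤
𝔉₁′  = IsNHat′

𝔉₂ 𝔉₂′ : ∀ {ℓ} → Pred (SubNormalFrame ℓ) ℓ
𝔉₂ _ = ⊤
𝔉₂′  = IsIdentity

-- Equality of frames is that of set theory: the carriers are equal, and along
-- that equality the relations (or subsets) have the same extension.

infix 4 _≋₁_ _≋₂_

record _≋₁_ {ℓ} (F G : NHatFrame ℓ) : Set (suc ℓ) where
  private
    module F = NHatFrame F
    module G = NHatFrame G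
  field
    X≡ : F.X ≡ G.X

  cast : F.X → G.X
  cast = subst id X≡

  field
    ≤⇔   : ∀ x y → x F.≤ y ⇔ cast x G.≤ cast y
    RN₁⇔ : ∀ x y → F.RN₁ x y ⇔ G.RN₁ (cast x) (cast y)
    RN₂⇔ : ∀ x y → F.RN₂ x y ⇔ G.RN₂ (cast x) (cast y)

record _≋₂_ {ℓ} (F G : SubNormalFrame ℓ) : Set (suc ℓ) where
  private
    module F = SubNormalFrame F
    module G = SubNormalFrame G
  field
    W≡ : F.W ≡ G.W

  cast : F.W → G.W
  cast = subst id W≡

  field
    ≤⇔  : ∀ x y → x F.≤ y ⇔ cast x G.≤ cast y
    Y₀⇔ : ∀ x → x ∈ F.Y₀ ⇔ cast x ∈ G.Y₀

-- Φ needs excluded middle only for the last condition on its target: to apply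
-- Y₀-cofinal, membership in Y₀ has to be extracted from its double negation.
Φ : ∀ {ℓ} → ExcludedMiddle ℓ → SubNormalFrame ℓ → NHatFrame ℓ
Φ {ℓ} em F = record
  { X        = W
  ; _≤_      = _≤_
  ; RN₁      = R₁
  ; RN₂      = R₂
  ; isHFrame = record
    { isJFrame = record
      { isNonemptyPoset = isNonemptyPoset
      ; down      = λ { p (z , q , r) s → z , trans p q , trans s r }
      ; symmetric = λ { (z , q , r) → z , r , q }
      ; condensed = λ { (z , q , r) → z , q , r , z , q , refl }
      }
    ; reflexive = λ {x} → x , refl , refl
    }
  ; isJFrame = record
    { isNonemptyPoset = isNonemptyPoset
    ; down      = λ { p (z , q , r , n) s → z , trans p q , trans s r , n }
    ; symmetric = λ { (z , q , r , n) → z , r , q , n }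
    ; condensed = λ { (z , q , r , n) → z , q , r , z , q , refl , n }
    }
  ; link     = link
  }
  where
  open SubNormalFrame F

  R₁ R₂ : Rel W ℓ
  R₁ x y = ∃[ z ] (x ≤ z × y ≤ z)
  R₂ x y = ∃[ z ] (x ≤ z × y ≤ z × z ∉ Y₀)

  link : ∀ x → (∀ y → R₁ x y → ∃[ z ] (R₁ y z × ¬ (∃[ z′ ] R₂ z z′))) →
         ¬ (∃[ z″ ] R₂ x z″)
  link x h (_ , w , x≤w , _ , w∉Y₀) = w∉Y₀ (Y₀-cofinal w above)
    where
    above : ∀ y → w ≤ y → ∃[ z ] (y ≤ z × z ∈ Y₀)
    above y w≤y with h y (y , trans x≤w w≤y , refl)
    ... | z , (u , y≤u , z≤u) , none =
      u , y≤u , em⇒dne em (λ u∉Y₀ → none (u , u , z≤u , refl , u∉Y₀))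

Ψ : ∀ {ℓ} → NHatFrame ℓ → SubNormalFrame ℓ
Ψ F = record
  { W               = X
  ; _≤_             = _≤_
  ; Y₀              = λ z → ¬ (∃[ x ] RN₂ z x)
  ; isNonemptyPoset = J.isNonemptyPoset
  ; Y₀-upset        = λ { p none (x , r) → none (x , J.down p r J.refl) }
  ; Y₀-cofinal      = λ x h → link x λ y xRy →
      let u , x≤u , y≤u , _ = H.condensed xRy
          z , u≤z , none    = h u x≤u
      in z , H.down (H.trans y≤u u≤z) H.reflexive H.refl , none
  }
  where
  open NHatFrame F
  module H = IsStrictlyCondensedHFrame isHFrame
  module J = IsStrictlyCondensedJFrame isJFrame

Φ-restricts : ∀ {ℓ} (em : ExcludedMiddle ℓ) (F : SubNormalFrame ℓ) →
              F ∈ 𝔉₂′ → Φ em F ∈ 𝔉₁′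
Φ-restricts em F identity x y (z , x≤z , y≤z , z∉Y₀) =
  trans y≤z (identity x z (z∉Y₀ ∘ Y₀-upset x≤z) z∉Y₀ x≤z)
  where open SubNormalFrame F

Ψ-restricts : ∀ {ℓ} → ExcludedMiddle ℓ → (F : NHatFrame ℓ) →
              F ∈ 𝔉₁′ → Ψ F ∈ 𝔉₂′
Ψ-restricts em F below x y _ y∉Y₀ x≤y =
  let t , yRt           = em⇒dne em y∉Y₀
      u , y≤u , _ , yRu = condensed yRt
  in trans y≤u (below x u (down x≤y yRu refl))
  where
  open NHatFrame F using (isJFrame)
  open IsStrictlyCondensedJFrame isJFrame

Φ∣𝔉₂′ : ∀ {ℓ} → ExcludedMiddle ℓ → ∃ (𝔉₂′ {ℓ}) → ∃ (𝔉₁′ {ℓ})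
Φ∣𝔉₂′ em (F , F∈) = Φ em F , Φ-restricts em F F∈

Ψ∣𝔉₁′ : ∀ {ℓ} → ExcludedMiddle ℓ → ∃ (𝔉₁′ {ℓ}) → ∃ (𝔉₂′ {ℓ})
Ψ∣𝔉₁′ em (F , F∈) = Ψ F , Ψ-restricts em F F∈

record Valuation (Var : Set) {ℓ} {X : Set ℓ} (_≤_ : Rel X ℓ) : Set (suc ℓ) where
  field
    ⟦_⟧   : Var → Pred X ℓ
    upset : ∀ p → IsUpset _≤_ ⟦ p ⟧

module SubNormalSemantics {Var : Set} {ℓ} (F : SubNormalFrame ℓ)
  (v : Valuation Var (SubNormalFrame._≤_ F)) where

  open SubNormalFrame F
  open Valuation v

  infix 3 _⊩_

  _⊩_ : W → Formula Var → Set ℓ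
  x ⊩ var p  = x ∈ ⟦ p ⟧
  x ⊩ ⊤ᶠ     = ⊤
  x ⊩ ⊥ᶠ     = ⊥
  x ⊩ α ∧ᶠ β = (x ⊩ α) × (x ⊩ β)
  x ⊩ α ∨ᶠ β = (x ⊩ α) ⊎ (x ⊩ β)
  x ⊩ α →ᶠ β = ∀ y → x ≤ y → y ⊩ α → y ⊩ β
  x ⊩ ¬ᶠ α   = ∀ y → x ≤ y → ¬ (y ⊩ α)
  x ⊩ ∼ᶠ α   = ∀ y → x ≤ y → y ⊩ α → y ∈ Y₀

module NHatSemantics {Var : Set} {ℓ} (F : NHatFrame ℓ)
  (v : Valuation Var (NHatFrame._≤_ F)) where

  open NHatFrame F
  open Valuation v

  infix 3 _⊩_

  _⊩_ : X → Formula Var → Set ℓ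
  x ⊩ var p  = x ∈ ⟦ p ⟧
  x ⊩ ⊤ᶠ     = ⊤
  x ⊩ ⊥ᶠ     = ⊥
  x ⊩ α ∧ᶠ β = (x ⊩ α) × (x ⊩ β)
  x ⊩ α ∨ᶠ β = (x ⊩ α) ⊎ (x ⊩ β)
  x ⊩ α →ᶠ β = ∀ y → x ≤ y → y ⊩ α → y ⊩ β
  x ⊩ ¬ᶠ α   = ∀ y → RN₁ x y → ¬ (y ⊩ α)
  x ⊩ ∼ᶠ α   = ∀ y → RN₂ x y → ¬ (y ⊩ α)

infix 3 _⊨₁_ _⊨₂_

_⊨₁_ : ∀ {ℓ} {Var : Set} → Pred (NHatFrame ℓ) ℓ → Formula Var → Set (suc ℓ)
_⊨₁_ {ℓ} {Var} 𝔉 α =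
  (F : NHatFrame ℓ) → F ∈ 𝔉 → (v : Valuation Var (NHatFrame._≤_ F)) →
  ∀ x → NHatSemantics._⊩_ F v x α

_⊨₂_ : ∀ {ℓ} {Var : Set} → Pred (SubNormalFrame ℓ) ℓ → Formula Var → Set (suc ℓ)
_⊨₂_ {ℓ} {Var} 𝔉 α =
  (F : SubNormalFrame ℓ) → F ∈ 𝔉 → (v : Valuation Var (SubNormalFrame._≤_ F)) →
  ∀ x → SubNormalSemantics._⊩_ F v x α

{-# OPTIONS --safe #-}
-- A strictly condensed relation is determined by the points it relates to
-- something: R x y holds iff x and y have a common upper bound z with R z t for
-- some t. For RN₁ every z qualifies by reflexivity, for RN₂ exactly the z ∉ Y₀.
-- So Φ and Ψ are mutually inverse, and since truth is persistent the clauses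
-- for ¬ and ∼ in terms of RN₁ and RN₂ agree with those in terms of ≤ and Y₀.
module Submission where

open import Defs
open import Level using (Level)
open import Axiom.DoubleNegationElimination using (em⇒dne)
open import Axiom.ExcludedMiddle using (ExcludedMiddle)
open import Data.Product using (∃; ∃-syntax; _×_; _,_; proj₁)
open import Data.Product.Function.NonDependent.Propositional using (_×-⇔_)
open import Data.Sum using (inj₁; inj₂)
open import Data.Sum.Function.Propositional using (_⊎-⇔_)
open import Data.Unit.Polymorphic using (tt)
open import Function.Bundles using (_⇔_; mk⇔; module Equivalence)
open import Function.Construct.Identity using (⇔-id)
open import Relation.Binary.PropositionalEquality using (refl)
open import Relation.Unary using (Pred; _∈_; _∉_)

open Equivalence using (to; from)

private
  variable
    ℓ : Level

module _ (F : NHatFrame ℓ) where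
  open NHatFrame F
  private
    module H = IsStrictlyCondensedHFrame isHFrame
    module J = IsStrictlyCondensedJFrame isJFrame

  -- Below a common upper bound `z`, `H.down` lowers both arguments of `RN₁ z z` at once.
  RN₁⇔bounded : ∀ x y → RN₁ x y ⇔ (∃[ z ] (x ≤ z × y ≤ z))
  RN₁⇔bounded x y = mk⇔
    (λ r → let z , x≤z , y≤z , _ = H.condensed r in z , x≤z , y≤z)
    (λ (z , x≤z , y≤z) → H.down x≤z H.reflexive y≤z)

  RN₂⇔bounded : ExcludedMiddle ℓ → ∀ x y →
    RN₂ x y ⇔ (∃[ z ] (x ≤ z × y ≤ z × z ∉ SubNormalFrame.Y₀ (Ψ F)))
  RN₂⇔bounded em x y = mk⇔
    (λ r → let z , x≤z , y≤z , xRz = J.condensed r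
           -- By symmetry the condensing point `z` is related back to `x`, which puts it outside
           -- `Y₀`.
           in z , x≤z , y≤z , λ none → none (x , J.symmetric xRz))
    (λ (z , x≤z , y≤z , z∉Y₀) →
       -- The point `t` need not lie above `y`; condensing trades it for some `u` above `z`, hence
       -- above `y`, so that `J.down` applies.
       let t , zRt           = em⇒dne em z∉Y₀
           u , z≤u , _ , zRu = J.condensed zRt
       in J.down x≤z zRu (J.trans y≤z z≤u))

ΦΨ≋id : (em : ExcludedMiddle ℓ) (F : NHatFrame ℓ) → Φ em (Ψ F) ≋₁ F
ΦΨ≋id em F = record
  { X≡   = refl
  ; ≤⇔   = λ x y → ⇔-id _
  ; RN₁⇔ = λ x y → mk⇔ (from (RN₁⇔bounded F x y)) (to (RN₁⇔bounded F x y))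
  ; RN₂⇔ = λ x y → mk⇔ (from (RN₂⇔bounded F em x y)) (to (RN₂⇔bounded F em x y))
  }

ΨΦ≋id : (em : ExcludedMiddle ℓ) (F : SubNormalFrame ℓ) → Ψ (Φ em F) ≋₂ F
ΨΦ≋id em F = record
  { W≡  = refl
  ; ≤⇔  = λ x y → ⇔-id _
  ; Y₀⇔ = λ x → mk⇔
      -- Outside `Y₀`, `x` would serve as its own common upper bound and so be related to itself.
      (λ none → em⇒dne em λ x∉Y₀ → none (x , x , F.refl , F.refl , x∉Y₀))
      (λ { x∈Y₀ (_ , w , x≤w , _ , w∉Y₀) → w∉Y₀ (F.Y₀-upset x≤w x∈Y₀) })
  }
  where module F = SubNormalFrame F

module _ {Var : Set} (F : NHatFrame ℓ) (v : Valuation Var (NHatFrame._≤_ F)) where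
  open NHatFrame F
  open NHatSemantics F v
  private
    module H = IsStrictlyCondensedHFrame isHFrame
    module J = IsStrictlyCondensedJFrame isJFrame

  -- Moves the truth of `α` from a related point up to a common upper bound. For both negations,
  -- lowering the first argument of the relation suffices.
  persistent : ∀ α {x y} → x ≤ y → x ⊩ α → y ⊩ α
  persistent (var p)  x≤y a        = Valuation.upset v p x≤y a
  persistent ⊤ᶠ       x≤y a        = tt
  persistent (α ∧ᶠ β) x≤y (a , b)  = persistent α x≤y a , persistent β x≤y b
  persistent (α ∨ᶠ β) x≤y (inj₁ a) = inj₁ (persistent α x≤y a)
  persistent (α ∨ᶠ β) x≤y (inj₂ b) = inj₂ (persistent β x≤y b)
  persistent (α →ᶠ β) x≤y f        = λ z y≤z → f z (H.trans x≤y y≤z)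
  persistent (¬ᶠ α)   x≤y f        = λ z yRz → f z (H.down x≤y yRz H.refl)
  persistent (∼ᶠ α)   x≤y f        = λ z yRz → f z (J.down x≤y yRz J.refl)

  -- The sub-normal frame is assembled from its components so that it shares the
  -- carrier and order of the N̂-frame definitionally; by record η this covers both
  -- a frame F with Φ em F and a frame F with Ψ F.
  module _ (em : ExcludedMiddle ℓ) {Y₀ : Pred X ℓ}
    (isNonemptyPoset : IsNonemptyPoset _≤_)
    (Y₀-upset : IsUpset _≤_ Y₀)
    (Y₀-cofinal : ∀ x → (∀ y → x ≤ y → ∃[ z ] (y ≤ z × z ∈ Y₀)) → x ∈ Y₀)
    (RN₁⇔ : ∀ x y → RN₁ x y ⇔ (∃[ z ] (x ≤ z × y ≤ z)))
    (RN₂⇔ : ∀ x y → RN₂ x y ⇔ (∃[ z ] (x ≤ z × y ≤ z × z ∉ Y₀))) where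

    private
      G : SubNormalFrame ℓ
      G = record
        { W = X ; _≤_ = _≤_ ; Y₀ = Y₀ ; isNonemptyPoset = isNonemptyPoset
        ; Y₀-upset = Y₀-upset ; Y₀-cofinal = Y₀-cofinal }

      module G = SubNormalFrame G
      module S = SubNormalSemantics G v

    ⊩-⇔ : ∀ α x → (x ⊩ α) ⇔ (x S.⊩ α)
    ⊩-⇔ (var p)  x = ⇔-id _
    ⊩-⇔ ⊤ᶠ       x = ⇔-id _
    ⊩-⇔ ⊥ᶠ       x = ⇔-id _
    ⊩-⇔ (α ∧ᶠ β) x = ⊩-⇔ α x ×-⇔ ⊩-⇔ β x
    ⊩-⇔ (α ∨ᶠ β) x = ⊩-⇔ α x ⊎-⇔ ⊩-⇔ β x
    ⊩-⇔ (α →ᶠ β) x = mk⇔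
      (λ f y x≤y a → to (⊩-⇔ β y) (f y x≤y (from (⊩-⇔ α y) a)))
      (λ f y x≤y a → from (⊩-⇔ β y) (f y x≤y (to (⊩-⇔ α y) a)))
    ⊩-⇔ (¬ᶠ α) x = mk⇔
      (λ f y x≤y a → f y (from (RN₁⇔ x y) (y , x≤y , G.refl)) (from (⊩-⇔ α y) a))
      (λ f y xRy a →
         let z , x≤z , y≤z = to (RN₁⇔ x y) xRy
         in f z x≤z (to (⊩-⇔ α z) (persistent α y≤z a)))
    ⊩-⇔ (∼ᶠ α) x = mk⇔
      -- If `y` were outside `Y₀`, it would itself be the bound witnessing `RN₂ x y`, and `f` would
      -- refute `α` there.
      (λ f y x≤y a → em⇒dne em λ y∉Y₀ →
         f y (from (RN₂⇔ x y) (y , x≤y , G.refl , y∉Y₀)) (from (⊩-⇔ α y) a))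
      (λ f y xRy a →
         let z , x≤z , y≤z , z∉Y₀ = to (RN₂⇔ x y) xRy
         in z∉Y₀ (f z x≤z (to (⊩-⇔ α z) (persistent α y≤z a))))

module _ {Var : Set} (em : ExcludedMiddle ℓ) where

  Φ-⊩ : (F : SubNormalFrame ℓ) (v : Valuation Var (SubNormalFrame._≤_ F)) → ∀ α x →
    NHatSemantics._⊩_ (Φ em F) v x α ⇔ SubNormalSemantics._⊩_ F v x α
  Φ-⊩ F v = ⊩-⇔ (Φ em F) v em isNonemptyPoset Y₀-upset Y₀-cofinal
    (λ x y → ⇔-id _) (λ x y → ⇔-id _)
    where open SubNormalFrame F

  Ψ-⊩ : (F : NHatFrame ℓ) (v : Valuation Var (NHatFrame._≤_ F)) → ∀ α x →
    NHatSemantics._⊩_ F v x α ⇔ SubNormalSemantics._⊩_ (Ψ F) v x α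
  Ψ-⊩ F v = ⊩-⇔ F v em isNonemptyPoset Y₀-upset Y₀-cofinal
    (RN₁⇔bounded F) (RN₂⇔bounded F em)
    where open SubNormalFrame (Ψ F)

  -- Both maps keep carrier and order, so the same valuation serves on a frame and on its image;
  -- each direction transfers along one map.
  valid-⇔ : {𝔉 : Pred (NHatFrame ℓ) ℓ} {𝔊 : Pred (SubNormalFrame ℓ) ℓ} →
    (∀ F → F ∈ 𝔊 → Φ em F ∈ 𝔉) → (∀ F → F ∈ 𝔉 → Ψ F ∈ 𝔊) →
    (α : Formula Var) → (𝔉 ⊨₁ α) ⇔ (𝔊 ⊨₂ α)
  valid-⇔ Φ∈ Ψ∈ α = mk⇔
    (λ valid F F∈ v x → to (Φ-⊩ F v α x) (valid (Φ em F) (Φ∈ F F∈) v x))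
    (λ valid F F∈ v x → from (Ψ-⊩ F v α x) (valid (Ψ F) (Ψ∈ F F∈) v x))

theorem5p7 : (ℓ : Level) (em : ExcludedMiddle ℓ) →
    ( ( ((F : NHatFrame ℓ) → Φ em (Ψ F) ≋₁ F)
    × ((F : SubNormalFrame ℓ) → Ψ (Φ em F) ≋₂ F) )
    × ( ((F : ∃ (𝔉₁′ {ℓ})) → proj₁ (Φ∣𝔉₂′ em (Ψ∣𝔉₁′ em F)) ≋₁ proj₁ F)
    × ((F : ∃ (𝔉₂′ {ℓ})) → proj₁ (Ψ∣𝔉₁′ em (Φ∣𝔉₂′ em F)) ≋₂ proj₁ F) ) )
    × ( (Var : Set) (α : Formula Var) →
    ((𝔉₁ {ℓ} ⊨₁ α) ⇔ (𝔉₂ {ℓ} ⊨₂ α))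
    × ((𝔉₁′ {ℓ} ⊨₁ α) ⇔ (𝔉₂′ {ℓ} ⊨₂ α)) )
theorem5p7 ℓ em =
  ( (ΦΨ≋id em , ΨΦ≋id em)
  -- Restricted frames are compared through their underlying frames, so the unrestricted laws apply.
  , (λ (F , _) → ΦΨ≋id em F) , (λ (F , _) → ΨΦ≋id em F) )
  , λ Var α →
      valid-⇔ em (λ _ _ → tt) (λ _ _ → tt) α
    , valid-⇔ em (Φ-restricts em) (Ψ-restricts em) α
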